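{- Let $\mathcal{A}$ be a monounary algebra. Then $\mathcal{A}$ is ultrahomogeneous if and only if $\mathcal{A}$ is $1$-ultrahomogeneous.
   Context: A monounary algebra is a pair $\mathcal{A}=(A;\theta)$ where $A$ is a nonempty set (of arbitrary cardinality) and $\theta\colon A\to A$ is a function. A subalgebra is a nonempty subset closed under $\theta$, with the restricted operation; for nonempty $B\subseteq A$, $\langle B\rangle=\{\theta^n(b): b\in B, n\geq 0\}$ is the subalgebra generated by $B$. A subalgebra is $n$-generated if it can be generated by $n$ elements. An isomorphism of monounary algebras is a bijection commuting with the unary operations. For $n\in\mathbb{N}=\{1,2,\dots\}$, $\mathcal{A}$ is $n$-ultrahomogeneous if every isomorphism between $n$-generated subalgebras of $\mathcal{A}$ extends to an automorphism of $\mathcal{A}$; $\mathcal{A}$ is ultrahomogeneous if it is $n$-ultrahomogeneous for every $n\in\mathbb{N}$. -}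

module Defs where

open import Data.Fin.Base using (Fin)
open import Data.Nat.Base using (ℕ; NonZero)
open import Data.Nat.GeneralisedArithmetic using (fold)
open import Data.Product.Base using (_×_; _,_; ∃; ∃-syntax; proj₁; map)
open import Function.Bundles using (Bijection)
open import Function.Definitions using (Congruent)
open import Level using (Level; _⊔_; suc)
open import Relation.Binary.Bundles using (Setoid)
open import Relation.Binary.Definitions using (_Respects_)
import Relation.Binary.Construct.On as On
open import Relation.Unary using (Pred; _∈_; _≐_; Satisfiable)

private
  variable
    c ℓ p : Level

-- Sets are setoids, so that a subset (a predicate respecting _≈_) is again a
-- set: its elements are compared without regard to their membership proofs.
-- The inhabitant only expresses nonemptiness; no morphism has to preserve it.
record MonounaryAlgebra c ℓ : Set (suc (c ⊔ ℓ)) where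
  field
    setoid : Setoid c ℓ
  open Setoid setoid public
  field
    inhabitant : Carrier
    θ          : Carrier → Carrier
    θ-cong     : Congruent _≈_ _≈_ θ

record Isomorphism {c₁ ℓ₁ c₂ ℓ₂} (𝒜 : MonounaryAlgebra c₁ ℓ₁) (ℬ : MonounaryAlgebra c₂ ℓ₂) :
                   Set (c₁ ⊔ ℓ₁ ⊔ c₂ ⊔ ℓ₂) where
  private
    module A = MonounaryAlgebra 𝒜
    module B = MonounaryAlgebra ℬ
  field
    bijection : Bijection A.setoid B.setoid
  open Bijection bijection public
  field
    commutes : ∀ x → to (A.θ x) B.≈ B.θ (to x)

Automorphism : MonounaryAlgebra c ℓ → Set (c ⊔ ℓ)
Automorphism 𝒜 = Isomorphism 𝒜 𝒜

module _ (𝒜 : MonounaryAlgebra c ℓ) where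
  open MonounaryAlgebra 𝒜

  -- c ⊔ ℓ is the level of the subalgebras generated by tuples of elements.
  record Subalgebra : Set (suc (c ⊔ ℓ)) where
    field
      subset   : Pred Carrier (c ⊔ ℓ)
      resp     : subset Respects _≈_
      nonempty : Satisfiable subset
      closed   : ∀ {x} → x ∈ subset → θ x ∈ subset

    algebra : MonounaryAlgebra (c ⊔ ℓ) ℓ
    algebra = record
      { setoid     = On.setoid setoid (proj₁ {B = subset})
      ; inhabitant = nonempty
      ; θ          = map θ closed
      ; θ-cong     = θ-cong
      }

  open Subalgebra

  -- fold b θ n is θⁿ(b).
  ⟨_⟩ : Pred Carrier p → Pred Carrier (c ⊔ ℓ ⊔ p)
  ⟨ B ⟩ x = ∃[ b ] ∃[ n ] b ∈ B × x ≈ fold b θ n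

  range : ∀ {n} → (Fin n → Carrier) → Pred Carrier ℓ
  range g x = ∃[ i ] x ≈ g i

  -- The n generators need not be distinct.
  IsGenerated : ℕ → Subalgebra → Set (c ⊔ ℓ)
  IsGenerated n B = ∃ λ (g : Fin n → Carrier) → subset B ≐ ⟨ range g ⟩

  Extends : {B C : Subalgebra} → Automorphism 𝒜 → Isomorphism (algebra B) (algebra C) → Set (c ⊔ ℓ)
  Extends {B} φ f = ∀ x (x∈B : x ∈ subset B) → φ.to x ≈ proj₁ (f.to (x , x∈B))
    where
    module φ = Isomorphism φ
    module f = Isomorphism f

  NUltrahomogeneous : ℕ → Set (suc (c ⊔ ℓ))
  NUltrahomogeneous n = (B C : Subalgebra) → IsGenerated n B → IsGenerated n C →
    (f : Isomorphism (algebra B) (algebra C)) → ∃[ φ ] Extends {B} {C} φ f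

  Ultrahomogeneous : Set (suc (c ⊔ ℓ))
  Ultrahomogeneous = ∀ n → .{{NonZero n}} → NUltrahomogeneous n

-- Ordering the generators, it suffices to treat one generator b at a time: the
-- previous ones generate a set B that may be assumed to be fixed, and b has to be
-- moved to some c by an automorphism fixing B, where θⁿ b = θⁿ c as soon as one of
-- them lies in B.  Say that x and y merge outside B if θⁱ x = θʲ y ∉ B for some i
-- and j.  This is a partial equivalence relation.  If ψ is an automorphism with
-- ψ b = c, which exists by 1-ultrahomogeneity, then ψ maps the class of b onto that
-- of c, and these classes are equal or disjoint.  The map that is ψ on the class of
-- b, ψ⁻¹ on the class of c (if different) and the identity elsewhere is the desired
-- automorphism: θ leaves these classes only by entering B, at a point θᵏ b = θᵏ c
-- that ψ fixes.
module Submission where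

open import Defs
open import Axiom.ExcludedMiddle using (ExcludedMiddle)
open import Data.Fin.Base using (Fin; zero; suc)
open import Data.Nat.Base using (ℕ; zero; suc; _+_; _∸_; _≤_)
open import Data.Nat.GeneralisedArithmetic using (fold; fold-+)
open import Data.Nat.Properties using (≤-total; m∸n+n≡m)
open import Data.Product.Base using (_×_; _,_; ∃-syntax; proj₁; proj₂)
open import Data.Sum.Base using (_⊎_; inj₁; inj₂)
open import Function.Base using (_∘_; const; id)
open import Function.Bundles using (Inverse; _⇔_; mk⇔)
open import Function.Properties.Bijection using (Bijection⇒Inverse)
import Function.Properties.Inverse as Inv
open import Level using (_⊔_)
open import Relation.Binary.Core using (Rel)
open import Relation.Binary.Definitions using (_Respects_; Symmetric; Transitive)
import Relation.Binary.PropositionalEquality.Core as ≡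
import Relation.Binary.Reasoning.Setoid as ≈-Reasoning
open import Relation.Nullary.Decidable.Core using (yes; no)
open import Relation.Nullary.Negation.Core using (¬_; contradiction)
open import Relation.Unary using (Pred; _∈_; _∉_)

module _ {a ℓ} (𝒜 : MonounaryAlgebra a ℓ) where
  open MonounaryAlgebra 𝒜
  open ≈-Reasoning setoid

  -- Iterates of `θ`.

  infix 30 θ^_
  θ^_ : ℕ → Carrier → Carrier
  (θ^ n) x = fold x θ n

  θ^-cong : ∀ n {x y} → x ≈ y → (θ^ n) x ≈ (θ^ n) y
  θ^-cong zero    x≈y = x≈y
  θ^-cong (suc n) x≈y = θ-cong (θ^-cong n x≈y)

  θ^-+ : ∀ m n x → (θ^ (m + n)) x ≈ (θ^ m) ((θ^ n) x)
  θ^-+ m n x = reflexive (fold-+ x θ m)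

  θ^-θ : ∀ n x → (θ^ n) (θ x) ≈ (θ^ suc n) x
  θ^-θ zero    x = refl
  θ^-θ (suc n) x = θ-cong (θ^-θ n x)

  -- The group of automorphisms.

  -- In contrast to an Automorphism, this comes with the inverse map.
  record Aut : Set (a ⊔ ℓ) where
    field
      inverse  : Inverse setoid setoid
    open Inverse inverse public hiding (inverse)
    field
      commutes : ∀ x → to (θ x) ≈ θ (to x)

    commutes-^ : ∀ n x → to ((θ^ n) x) ≈ (θ^ n) (to x)
    commutes-^ zero    x = refl
    commutes-^ (suc n) x = trans (commutes _) (θ-cong (commutes-^ n x))

    injective : ∀ {x y} → to x ≈ to y → x ≈ y
    injective {x} {y} eq = begin
      x           ≈⟨ strictlyInverseʳ x ⟨
      from (to x) ≈⟨ from-cong eq ⟩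
      from (to y) ≈⟨ strictlyInverseʳ y ⟩
      y           ∎

  idAut : Aut
  idAut = record { inverse = Inv.refl setoid ; commutes = λ _ → refl }

  compose : Aut → Aut → Aut
  compose φ ψ = record
    { inverse  = Inv.trans φ.inverse ψ.inverse
    ; commutes = λ x → trans (ψ.to-cong (φ.commutes x)) (ψ.commutes (φ.to x))
    }
    where
    module φ = Aut φ
    module ψ = Aut ψ

  invert : Aut → Aut
  invert φ = record
    { inverse  = Inv.sym inverse
    ; commutes = λ x → injective (begin
        to (from (θ x))   ≈⟨ strictlyInverseˡ (θ x) ⟩
        θ x               ≈⟨ θ-cong (strictlyInverseˡ x) ⟨
        θ (to (from x))   ≈⟨ commutes (from x) ⟨
        to (θ (from x))   ∎)
    }
    where open Aut φ

  toAutomorphism : Aut → Automorphism 𝒜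
  toAutomorphism φ = record
    { bijection = Inv.Inverse⇒Bijection (Aut.inverse φ)
    ; commutes  = Aut.commutes φ
    }

  fromAutomorphism : Automorphism 𝒜 → Aut
  fromAutomorphism φ = record
    { inverse  = Bijection⇒Inverse (Isomorphism.bijection φ)
    ; commutes = Isomorphism.commutes φ
    }

  -- Merging outside a closed set, and the automorphism exchanging two classes.

  module Exchange (em : ExcludedMiddle (a ⊔ ℓ)) (B : Pred Carrier (a ⊔ ℓ))
                  (resp : B Respects _≈_) (closed : ∀ {x} → x ∈ B → θ x ∈ B) where

    closed-^ : ∀ n {x} → x ∈ B → (θ^ n) x ∈ B
    closed-^ zero    x∈B = x∈B
    closed-^ (suc n) x∈B = closed (closed-^ n x∈B)

    Merge : Rel Carrier (a ⊔ ℓ)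
    Merge x y = ∃[ i ] ∃[ j ] (θ^ i) x ≈ (θ^ j) y × (θ^ j) y ∉ B

    Merge-sym : Symmetric Merge
    Merge-sym (i , j , eq , ∉B) = j , i , sym eq , λ ∈B → ∉B (resp eq ∈B)

    Merge-respˡ : ∀ {x y z} → x ≈ y → Merge x z → Merge y z
    Merge-respˡ x≈y (i , j , eq , ∉B) = i , j , trans (θ^-cong i (sym x≈y)) eq , ∉B

    -- The orbit of `y` meets that of `x` no later than that of `z`. Applying `θ^ (k ∸ j)` carries
    -- the earlier meeting point to the later one, which is known to lie outside `B`.
    Merge-trans-≤ : ∀ {x y z} i {j k} l → j ≤ k → (θ^ i) x ≈ (θ^ j) y →
                    (θ^ k) y ≈ (θ^ l) z → (θ^ l) z ∉ B → Merge x z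
    Merge-trans-≤ {x} {y} {z} i {j} {k} l j≤k eq₁ eq₂ ∉B = (k ∸ j) + i , l , (begin
      (θ^ (k ∸ j + i)) x      ≈⟨ θ^-+ (k ∸ j) i x ⟩
      (θ^ (k ∸ j)) ((θ^ i) x) ≈⟨ θ^-cong (k ∸ j) eq₁ ⟩
      (θ^ (k ∸ j)) ((θ^ j) y) ≈⟨ θ^-+ (k ∸ j) j y ⟨
      (θ^ (k ∸ j + j)) y      ≡⟨ ≡.cong (λ m → (θ^ m) y) (m∸n+n≡m j≤k) ⟩
      (θ^ k) y                ≈⟨ eq₂ ⟩
      (θ^ l) z                ∎) , ∉B

    Merge-trans : Transitive Merge
    Merge-trans (i , j , eq₁ , ∉B₁) (k , l , eq₂ , ∉B₂) with ≤-total j k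
    ... | inj₁ j≤k = Merge-trans-≤ i l j≤k eq₁ eq₂ ∉B₂
    ... | inj₂ k≤j = Merge-sym
      (Merge-trans-≤ l i k≤j (sym eq₂) (sym eq₁) (λ ∈B → ∉B₁ (resp eq₁ ∈B)))

    Merge-θ⁻ : ∀ {x y} → Merge (θ x) y → Merge x y
    Merge-θ⁻ {x} (i , j , eq , ∉B) = suc i , j , trans (sym (θ^-θ i x)) eq , ∉B

    Merge⇒∉ : ∀ {x y} → Merge x y → x ∉ B
    Merge⇒∉ (i , j , eq , ∉B) x∈B = ∉B (resp eq (closed-^ i x∈B))

    -- For positive `i` the meeting point is still an iterate of `θ x`. For `i` zero, `x` is itself
    -- an iterate of `y`, and its successor either stays outside `B` and is a new meeting point, or
    -- enters `B`.
    Merge-θ : ∀ {x y} → Merge x y → Merge (θ x) y ⊎ (θ x ∈ B × ∃[ k ] θ x ≈ (θ^ k) y)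
    Merge-θ {x} (suc i , j , eq , ∉B) = inj₁ (i , j , trans (θ^-θ i x) eq , ∉B)
    Merge-θ {x} {y} (zero , j , eq , ∉B) with em {P = (θ^ suc j) y ∈ B}
    ... | yes ∈B = inj₂ (resp (sym (θ-cong eq)) ∈B , suc j , θ-cong eq)
    ... | no ∉B′ = inj₁ (zero , suc j , θ-cong eq , ∉B′)

    -- `aut` need not fix `B`. The fields `agreeˡ` and `agreeʳ` say that the orbits of `b` and `c`
    -- are in `B` at the same times and then coincide, which is necessary for an automorphism fixing
    -- `B` to take `b` to `c`.
    record Exchangeable (b c : Carrier) : Set (a ⊔ ℓ) where
      field
        aut    : Aut
        maps   : Aut.to aut b ≈ c
        agreeˡ : ∀ n → (θ^ n) b ∈ B → (θ^ n) b ≈ (θ^ n) c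
        agreeʳ : ∀ n → (θ^ n) c ∈ B → (θ^ n) b ≈ (θ^ n) c
      open Aut aut public

      maps-^ : ∀ n → to ((θ^ n) b) ≈ (θ^ n) c
      maps-^ n = trans (commutes-^ n b) (θ^-cong n maps)

      to-Merge : ∀ {x} → Merge x b → Merge (to x) c
      to-Merge {x} (i , j , eq , ∉B) = i , j , (begin
        (θ^ i) (to x)   ≈⟨ commutes-^ i x ⟨
        to ((θ^ i) x)   ≈⟨ to-cong eq ⟩
        to ((θ^ j) b)   ≈⟨ maps-^ j ⟩
        -- The meeting point stays outside `B` because the two orbits are in `B` at the same times.
        (θ^ j) c        ∎) , λ ∈B → ∉B (resp (sym (agreeʳ j ∈B)) ∈B)

      fixes-exit : ∀ {x} k → x ∈ B → x ≈ (θ^ k) b → to x ≈ x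
      fixes-exit {x} k x∈B eq = begin
        to x          ≈⟨ to-cong eq ⟩
        to ((θ^ k) b) ≈⟨ maps-^ k ⟩
        (θ^ k) c      ≈⟨ agreeˡ k (resp eq x∈B) ⟨
        (θ^ k) b      ≈⟨ eq ⟨
        x             ∎

    flip : ∀ {b c} → Exchangeable b c → Exchangeable c b
    flip {b} e = record
      { aut    = invert aut
      ; maps   = trans (from-cong (sym maps)) (strictlyInverseʳ b)
      ; agreeˡ = λ n ∈B → sym (agreeʳ n ∈B)
      ; agreeʳ = λ n ∈B → sym (agreeˡ n ∈B)
      }
      where open Exchangeable e

    -- The order of the tests matters when the two classes coincide: `to` alone then acts on the
    -- common class, and `from` alone does so for `flip e`, so the two maps remain mutually inverse.
    exchange : ∀ {b c} → Exchangeable b c → Carrier → Carrier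
    exchange {b} {c} e x with em {P = Merge x b} | em {P = Merge x c}
    ... | yes _ | _     = Exchangeable.to e x
    ... | no _  | yes _ = Exchangeable.from e x
    ... | no _  | no _  = x

    module _ {b c} (e : Exchangeable b c) where
      open Exchangeable e

      exchange-to : ∀ {x} → Merge x b → exchange e x ≈ to x
      exchange-to {x} m with em {P = Merge x b} | em {P = Merge x c}
      ... | yes _ | _ = refl
      ... | no ¬m | _ = contradiction m ¬m

      exchange-from : ∀ {x} → ¬ Merge x b → Merge x c → exchange e x ≈ from x
      exchange-from {x} ¬m m with em {P = Merge x b} | em {P = Merge x c}
      ... | yes m′ | _     = contradiction m′ ¬m
      ... | no _   | yes _ = refl
      ... | no _   | no ¬n = contradiction m ¬n

      exchange-id : ∀ {x} → ¬ Merge x b → ¬ Merge x c → exchange e x ≈ x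
      exchange-id {x} ¬m ¬n with em {P = Merge x b} | em {P = Merge x c}
      ... | yes m | _     = contradiction m ¬m
      ... | no _  | yes n = contradiction n ¬n
      ... | no _  | no _  = refl

      exchange-fixes : ∀ {x} → x ∈ B → exchange e x ≈ x
      exchange-fixes x∈B = exchange-id (λ m → Merge⇒∉ m x∈B) (λ m → Merge⇒∉ m x∈B)

      exchange-cong : ∀ {x y} → x ≈ y → exchange e x ≈ exchange e y
      exchange-cong {x} {y} x≈y with em {P = Merge x b} | em {P = Merge x c}
      ... | yes m | _     = trans (to-cong x≈y) (sym (exchange-to (Merge-respˡ x≈y m)))
      ... | no ¬m | yes n = trans (from-cong x≈y)
        (sym (exchange-from (¬m ∘ Merge-respˡ (sym x≈y)) (Merge-respˡ x≈y n)))
      ... | no ¬m | no ¬n = trans x≈y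
        (sym (exchange-id (¬m ∘ Merge-respˡ (sym x≈y)) (¬n ∘ Merge-respˡ (sym x≈y))))

      exchange-commutes : ∀ x → exchange e (θ x) ≈ θ (exchange e x)
      exchange-commutes x with em {P = Merge x b} | em {P = Merge x c}
      -- No point enters a class from outside, since merging of `θ x` entails merging of `x`.
      ... | no ¬m | no ¬n = exchange-id (¬m ∘ Merge-θ⁻) (¬n ∘ Merge-θ⁻)
      ... | yes m | _ with Merge-θ m
      ...   | inj₁ m′             = trans (exchange-to m′) (commutes x)
      ...   | inj₂ (∈B , k , eq) = begin
        exchange e (θ x) ≈⟨ exchange-fixes ∈B ⟩
        θ x              ≈⟨ fixes-exit k ∈B eq ⟨
        to (θ x)         ≈⟨ commutes x ⟩
        θ (to x)         ∎
      exchange-commutes x | no ¬m | yes n with Merge-θ n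
      ...   | inj₁ n′             =
        trans (exchange-from (¬m ∘ Merge-θ⁻) n′) (Aut.commutes (invert aut) x)
      ...   | inj₂ (∈B , k , eq) = begin
        exchange e (θ x) ≈⟨ exchange-fixes ∈B ⟩
        θ x              ≈⟨ Exchangeable.fixes-exit (flip e) k ∈B eq ⟨
        from (θ x)       ≈⟨ Aut.commutes (invert aut) x ⟩
        θ (from x)       ∎

    -- e⁻¹ is not just flip e, as flip (flip e) is not definitionally equal to e.
    exchange-inverse : ∀ {b c} (e : Exchangeable b c) (e⁻¹ : Exchangeable c b) →
      (∀ x → Exchangeable.to e⁻¹ x ≈ Exchangeable.from e x) →
      (∀ x → Exchangeable.from e⁻¹ x ≈ Exchangeable.to e x) →
      ∀ x → exchange e⁻¹ (exchange e x) ≈ x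
    exchange-inverse {b} {c} e e⁻¹ to≈ from≈ x with em {P = Merge x b} | em {P = Merge x c}
    ... | no ¬m | no ¬n = exchange-id e⁻¹ ¬n ¬m
    ... | yes m | _     =
      trans (exchange-to e⁻¹ (to-Merge m)) (trans (to≈ (to x)) (strictlyInverseʳ x))
      where open Exchangeable e
    ... | no ¬m | yes n =
      trans (exchange-from e⁻¹ disjoint from-Merge) (trans (from≈ (from x)) (strictlyInverseˡ x))
      where
      open Exchangeable e
      from-Merge : Merge (from x) b
      from-Merge = Exchangeable.to-Merge (flip e) n
      -- Otherwise `from x` would link the classes of `b` and `c`, and `x` would merge with `b`.
      disjoint : ¬ Merge (from x) c
      disjoint m = ¬m (Merge-trans n (Merge-trans (Merge-sym m) from-Merge))

    exchangeAut : ∀ {b c} → Exchangeable b c → Aut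
    exchangeAut e = record
      { inverse  = record
        { to        = exchange e
        ; from      = exchange (flip e)
        ; to-cong   = exchange-cong e
        ; from-cong = exchange-cong (flip e)
        ; inverse   =
            (λ {x} eq → trans (exchange-cong e eq)
                       (exchange-inverse (flip e) e (λ _ → refl) (λ _ → refl) x)) ,
            (λ {x} eq → trans (exchange-cong (flip e) eq)
                       (exchange-inverse e (flip e) (λ _ → refl) (λ _ → refl) x))
        }
      ; commutes = exchange-commutes e
      }

    exchange-maps : ∀ {b c} (e : Exchangeable b c) → exchange e b ≈ c
    exchange-maps {b} e with em {P = b ∈ B}
    -- Here `b` does not merge even with itself, but agreement at exponent 0 already gives `b ≈ c`.
    ... | yes b∈B = trans (exchange-fixes e b∈B) (Exchangeable.agreeˡ e 0 b∈B)
    ... | no  b∉B = trans (exchange-to e (0 , 0 , refl , b∉B)) (Exchangeable.maps e)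

  -- Tuples of generators and the relations between their iterates.

  Span : ∀ {n} → (Fin n → Carrier) → Pred Carrier (a ⊔ ℓ)
  Span g = ⟨_⟩ 𝒜 (range 𝒜 g)

  Span-resp : ∀ {n} (g : Fin n → Carrier) → Span g Respects _≈_
  Span-resp g x≈y (b , n , b∈g , eq) = b , n , b∈g , trans (sym x≈y) eq

  Span-closed : ∀ {n} (g : Fin n → Carrier) {x} → x ∈ Span g → θ x ∈ Span g
  Span-closed g (b , n , b∈g , eq) = b , suc n , b∈g , θ-cong eq

  Span-elim : ∀ {n} (g : Fin n → Carrier) {x} → x ∈ Span g → ∃[ i ] ∃[ k ] x ≈ (θ^ k) (g i)
  Span-elim g (b , k , (i , b≈gi) , eq) = i , k , trans eq (θ^-cong k b≈gi)

  infix 4 _≾_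
  -- This is what makes sending each `g i` to `h i` extend to a well-defined homomorphism from
  -- `Span g` to `Span h`; the converse relation makes it injective.
  _≾_ : ∀ {n} → Rel (Fin n → Carrier) ℓ
  g ≾ h = ∀ i j s t → (θ^ s) (g i) ≈ (θ^ t) (g j) → (θ^ s) (h i) ≈ (θ^ t) (h j)

  ≾-to : ∀ {n} (φ : Aut) (g : Fin n → Carrier) → g ≾ Aut.to φ ∘ g
  ≾-to φ g i j s t eq = begin
    (θ^ s) (to (g i)) ≈⟨ commutes-^ s (g i) ⟨
    to ((θ^ s) (g i)) ≈⟨ to-cong eq ⟩
    to ((θ^ t) (g j)) ≈⟨ commutes-^ t (g j) ⟩
    (θ^ t) (to (g j)) ∎
    where open Aut φ

  ≾-to⁻ : ∀ {n} (φ : Aut) (g : Fin n → Carrier) → Aut.to φ ∘ g ≾ g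
  ≾-to⁻ φ g i j s t eq = injective (begin
    to ((θ^ s) (g i)) ≈⟨ commutes-^ s (g i) ⟩
    (θ^ s) (to (g i)) ≈⟨ eq ⟩
    (θ^ t) (to (g j)) ≈⟨ commutes-^ t (g j) ⟨
    to ((θ^ t) (g j)) ∎)
    where open Aut φ

  -- Isomorphisms between 1-generated subalgebras.

  principal : Carrier → Subalgebra 𝒜
  principal b = record
    { subset   = Span {1} (const b)
    ; resp     = Span-resp {1} (const b)
    ; nonempty = b , b , 0 , (zero , refl) , refl
    ; closed   = Span-closed {1} (const b)
    }

  principal-generated : ∀ b → IsGenerated 𝒜 1 (principal b)
  principal-generated b = const b , id , id

  -- The exponent stored in a membership proof determines the image. The first hypothesis makes the
  -- image independent of the chosen exponent, the second gives injectivity.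
  principal-iso : ∀ {b c} → const {B = Fin 1} b ≾ const c → const {B = Fin 1} c ≾ const b →
                  Isomorphism (Subalgebra.algebra (principal b)) (Subalgebra.algebra (principal c))
  principal-iso {b} {c} b≾c c≾b = record
    { bijection = record
      { to        = to
      ; cong      = λ {x} {y} → cong {x} {y}
      ; bijective = (λ {x} {y} → injective {x} {y}) , surjective
      }
    ; commutes  = λ _ → refl
    }
    where
    module B = MonounaryAlgebra (Subalgebra.algebra (principal b))
    module C = MonounaryAlgebra (Subalgebra.algebra (principal c))

    exponent : ∀ {d x} → x ∈ Span {1} (const d) → ∃[ k ] x ≈ (θ^ k) d
    exponent x∈ = proj₂ (Span-elim (const _) x∈)

    power : ∀ d → ℕ → MonounaryAlgebra.Carrier (Subalgebra.algebra (principal d))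
    power d k = (θ^ k) d , d , k , (zero , refl) , refl

    to : B.Carrier → C.Carrier
    to (_ , _ , k , _) = power c k

    cong : ∀ {x y} → x B.≈ y → to x C.≈ to y
    cong {_ , x∈} {_ , y∈} x≈y = b≾c zero zero (proj₁ (exponent x∈)) (proj₁ (exponent y∈))
      (trans (sym (proj₂ (exponent x∈))) (trans x≈y (proj₂ (exponent y∈))))

    injective : ∀ {x y} → to x C.≈ to y → x B.≈ y
    injective {_ , x∈} {_ , y∈} eq =
      trans (proj₂ (exponent x∈)) (trans
        (c≾b zero zero (proj₁ (exponent x∈)) (proj₁ (exponent y∈)) eq)
        (sym (proj₂ (exponent y∈))))

    surjective : ∀ y → ∃[ x ] (∀ {z} → z B.≈ x → to z C.≈ y)
    surjective (_ , y∈) = power b k , λ {z} z≈ →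
      trans (cong {z} {power b k} z≈) (sym (proj₂ (exponent y∈)))
      where k = proj₁ (exponent y∈)

  -- Extension of isomorphisms, by induction on the number of generators.

  module _ (em : ExcludedMiddle (a ⊔ ℓ)) (1-uh : NUltrahomogeneous 𝒜 1) where

    extend-principal : ∀ {b c} → const {B = Fin 1} b ≾ const c → const {B = Fin 1} c ≾ const b →
                       ∃[ φ ] Aut.to φ b ≈ c
    extend-principal {b} {c} b≾c c≾b
      with φ , ext ← 1-uh (principal b) (principal c) (principal-generated b)
                          (principal-generated c) (principal-iso b≾c c≾b)
      = fromAutomorphism φ , ext b (b , 0 , (zero , refl) , refl)

    extend-tuple : ∀ {n} (g h : Fin n → Carrier) → g ≾ h → h ≾ g →
                   ∃[ φ ] ∀ i → Aut.to φ (g i) ≈ h i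
    extend-tuple {zero}  g h g≾h h≾g = idAut , λ ()
    extend-tuple {suc n} g h g≾h h≾g
      with φ , φg≈h ← extend-tuple (g ∘ suc) (h ∘ suc)
                        (λ i j → g≾h (suc i) (suc j)) (λ i j → h≾g (suc i) (suc j))
      -- `φ` settles the tail. Pulling `h` back along it yields `h′`, which agrees with `g` on the
      -- tail, so it remains to move `g zero` to `h′ zero` with the tail fixed, before applying `φ`.
      = compose (exchangeAut e) φ , λ where
          zero    → trans (φ.to-cong (exchange-maps e)) (φ.strictlyInverseˡ (h zero))
          (suc i) → trans (φ.to-cong (exchange-fixes e (g-suc∈ i))) (φg≈h i)
      where
      module φ = Aut φ
      -- For `n` zero this span is empty, hence a closed predicate and not a `Subalgebra`.
      open Exchange em (Span (g ∘ suc)) (Span-resp (g ∘ suc)) (Span-closed (g ∘ suc))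

      h′ : Fin (suc n) → Carrier
      h′ = φ.from ∘ h

      g≾h′ : g ≾ h′
      g≾h′ i j s t = ≾-to (invert φ) h i j s t ∘ g≾h i j s t

      h′≾g : h′ ≾ g
      h′≾g i j s t = h≾g i j s t ∘ ≾-to⁻ (invert φ) h i j s t

      h′≈g : ∀ i → h′ (suc i) ≈ g (suc i)
      h′≈g i = trans (φ.from-cong (sym (φg≈h i))) (φ.strictlyInverseʳ (g (suc i)))

      g-suc∈ : ∀ i → g (suc i) ∈ Span (g ∘ suc)
      g-suc∈ i = g (suc i) , 0 , (i , refl) , refl

      e : Exchangeable (g zero) (h′ zero)
      e = record
        { aut    = proj₁ ψ
        ; maps   = proj₂ ψ
        -- Lying in the span is a relation with some tail generator; it transfers between `g` and
        -- `h′`, which share that generator.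
        ; agreeˡ = λ n ∈B → let i , k , eq = Span-elim (g ∘ suc) ∈B in
            trans eq (trans (θ^-cong k (sym (h′≈g i))) (sym (g≾h′ zero (suc i) n k eq)))
        ; agreeʳ = λ n ∈B → let i , k , eq = Span-elim (g ∘ suc) ∈B in
            trans (h′≾g zero (suc i) n k (trans eq (θ^-cong k (sym (h′≈g i))))) (sym eq)
        }
        where
        ψ : ∃[ ψ ] Aut.to ψ (g zero) ≈ h′ zero
        ψ = extend-principal (λ _ _ → g≾h′ zero zero) (λ _ _ → h′≾g zero zero)

    ultrahomogeneous : Ultrahomogeneous 𝒜
    ultrahomogeneous n B C (g , B⊆⟨g⟩ , ⟨g⟩⊆B) _ f =
      toAutomorphism φ , λ x x∈B → let i , k , eq = Span-elim g (B⊆⟨g⟩ x∈B) in begin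
          Aut.to φ x                ≈⟨ Aut.to-cong φ eq ⟩
          Aut.to φ ((θ^ k) (g i))   ≈⟨ Aut.commutes-^ φ k (g i) ⟩
          (θ^ k) (Aut.to φ (g i))   ≈⟨ θ^-cong k (proj₂ extension i) ⟩
          (θ^ k) (h i)              ≈⟨ f-^ i k ⟨
          proj₁ (f.to (power i k))  ≈⟨ f.cong {power i k} {x , x∈B} (sym eq) ⟩
          proj₁ (f.to (x , x∈B))    ∎
      where
      module f = Isomorphism f
      module B = MonounaryAlgebra (Subalgebra.algebra B)

      power : Fin n → ℕ → B.Carrier
      power i k = (θ^ k) (g i) , ⟨g⟩⊆B (g i , k , (i , refl) , refl)

      h : Fin n → Carrier
      h i = proj₁ (f.to (power i 0))

      f-^ : ∀ i k → proj₁ (f.to (power i k)) ≈ (θ^ k) (h i)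
      f-^ i zero    = refl
      f-^ i (suc k) = begin
        -- The two arguments have the same underlying element and may differ only in their
        -- membership proofs.
        proj₁ (f.to (power i (suc k)))    ≈⟨ f.cong {power i (suc k)} {B.θ (power i k)} refl ⟩
        proj₁ (f.to (B.θ (power i k)))    ≈⟨ f.commutes (power i k) ⟩
        θ (proj₁ (f.to (power i k)))      ≈⟨ θ-cong (f-^ i k) ⟩
        (θ^ suc k) (h i)                  ∎

      g≾h : g ≾ h
      g≾h i j s t eq =
        trans (sym (f-^ i s)) (trans (f.cong {power i s} {power j t} eq) (f-^ j t))

      h≾g : h ≾ g
      h≾g i j s t eq =
        f.injective {power i s} {power j t} (trans (f-^ i s) (trans eq (sym (f-^ j t))))

      extension : ∃[ φ ] ∀ i → Aut.to φ (g i) ≈ h i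
      extension = extend-tuple g h g≾h h≾g

      φ : Aut
      φ = proj₁ extension

proposition4p1 : ∀ {c ℓ} → ExcludedMiddle (c ⊔ ℓ) →
    (𝒜 : MonounaryAlgebra c ℓ) → Ultrahomogeneous 𝒜 ⇔ NUltrahomogeneous 𝒜 1
proposition4p1 em 𝒜 = mk⇔ (λ uh → uh 1) (ultrahomogeneous 𝒜 em)
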